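{- Up to isomorphism, there are exactly eight $3$-dicritical semi-complete digraphs, namely: (1) $\overleftrightarrow{K_3}$, the bidirected complete graph on 3 vertices (three vertices, all six arcs); (2) $\vec{W_3}$: a directed triangle $a\to b\to c\to a$ together with a vertex $r$ joined by a digon to each of $a,b,c$; (3) $\mathcal{H}_5$: vertex set $\{u_0,\dots,u_4\}$, with digons between $u_0$ and $u_1$ and between $u_0$ and $u_4$, and the simple arcs $u_4u_1$, $u_1u_3$, $u_1u_2$, $u_3u_4$, $u_2u_4$, $u_3u_0$, $u_0u_2$, $u_2u_3$; (4)–(7) the four digraphs $\mathcal{R}(H_1,H_2)$ with $H_1,H_2\in\{\overleftrightarrow{K_2},\vec{C_3}\}$; (8) the Paley tournament $\mathcal{P}_7$ with vertex set $\mathbb{Z}_7$ and arcs $i\to i+1$, $i\to i+2$, $i\to i+4$ for all $i\in\mathbb{Z}_7$.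
   Context: Digraphs are finite, with no loops and no parallel arcs; a digon is a pair of arcs $uv,vu$. A $2$-dicolouring of $D$ is a map $V(D)\to\{1,2\}$ such that each colour class induces an acyclic subdigraph (a digon is a directed cycle). $D$ is $3$-dicritical if $D$ has no $2$-dicolouring but every proper subdigraph has one. $D$ is semi-complete if every two distinct vertices are joined by at least one arc. $\overleftrightarrow{K_2}$ is a digon on two vertices; $\vec{C_3}$ is the directed triangle. For digraphs $H_1,H_2$, $\mathcal{R}(H_1,H_2)$ is the digraph obtained from disjoint copies of $H_1$ and $H_2$ and one new vertex $r$ by adding all arcs from $r$ to every vertex of $H_1$, all arcs from every vertex of $H_1$ to every vertex of $H_2$, and all arcs from every vertex of $H_2$ to $r$. -}

module Defs where

open import Data.Bool using (Bool; true; false; T; not; _∧_)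
open import Data.Bool.Properties using (T?)
open import Data.Bool.ListAction using (any)
open import Data.Fin using (Fin; zero; suc; toℕ; splitAt; _≟_)
open import Data.Fin.Properties using (all?)
open import Data.Fin.Subset using (Subset; _∈_; _∉_)
open import Data.List using (List; []; _∷_; _∷ʳ_; _++_)
open import Data.List.Relation.Unary.Linked using (Linked)
open import Data.List.Relation.Unary.Unique.Propositional using (Unique)
open import Data.Nat using (ℕ; zero; suc; _+_; _%_; NonZero; _≡ᵇ_)
open import Data.Product using (Σ; ∃; ∃₂; _×_; _,_; proj₁; proj₂)
open import Data.Sum using (_⊎_; inj₁; inj₂)
open import Data.Vec using (Vec; []; _∷_)
open import Function using (_on_; _↔_; Inverse)
open import Level using (0ℓ)
open import Relation.Binary.Core using (Rel)
open import Relation.Binary.PropositionalEquality using (_≡_; _≢_; refl)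
open import Relation.Nullary using (¬_; Dec; yes; no)
open import Relation.Nullary.Decidable using (¬?; ⌊_⌋; from-yes)

record Digraph : Set where
  field
    order    : ℕ
    arc      : Fin order → Fin order → Bool
    loopless : ∀ v → ¬ T (arc v v)

  Vertex : Set
  Vertex = Fin order

  infix 4 _⟶_
  _⟶_ : Rel Vertex 0ℓ
  u ⟶ v = T (arc u v)

open Digraph using (order; Vertex)

SemiComplete : Digraph → Set
SemiComplete D = ∀ u v → u ≢ v → u ⟶ v ⊎ v ⟶ u
  where open Digraph D using (_⟶_)

infix 4 _≅_
record _≅_ (D E : Digraph) : Set where
  field
    vertices : Vertex D ↔ Vertex E
    arcs     : ∀ u v → Digraph.arc E (Inverse.to vertices u) (Inverse.to vertices v)
                     ≡ Digraph.arc D u v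

-- Acyclicity and dicolourings are defined for arc relations on arbitrary vertex
-- types, so that they apply to digraphs, their subdigraphs and colour classes.

-- On an irreflexive relation the list rest is necessarily nonempty; a digon is
-- a directed cycle of length 2.
record DirectedCycle {V : Set} (R : Rel V 0ℓ) : Set where
  field
    start    : V
    rest     : List V
    distinct : Unique (start ∷ rest)
    linked   : Linked R (start ∷ rest ∷ʳ start)

Acyclic : {V : Set} → Rel V 0ℓ → Set
Acyclic R = ¬ DirectedCycle R

Induced : {V : Set} → Rel V 0ℓ → (P : V → Set) → Rel (Σ V P) 0ℓ
Induced R P = R on proj₁

IsDicolouring : {V : Set} (k : ℕ) → Rel V 0ℓ → (V → Fin k) → Set
IsDicolouring k R c = ∀ i → Acyclic (Induced R (λ v → c v ≡ i))

Dicolourable : {V : Set} → ℕ → Rel V 0ℓ → Set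
Dicolourable k R = ∃ (IsDicolouring k R)

record Subdigraph (D : Digraph) : Set where
  field
    vertices : Subset (order D)
    arc      : Vertex D → Vertex D → Bool
    arc⊆     : ∀ {u v} → T (arc u v) → Digraph._⟶_ D u v
    source∈  : ∀ {u v} → T (arc u v) → u ∈ vertices
    target∈  : ∀ {u v} → T (arc u v) → v ∈ vertices

  infix 4 _⟶_
  _⟶_ : Rel (∃ (_∈ vertices)) 0ℓ
  (u , _) ⟶ (v , _) = T (arc u v)

Proper : {D : Digraph} → Subdigraph D → Set
Proper {D} H = (∃ λ v → v ∉ vertices) ⊎ (∃₂ λ u v → u ⟶ v × ¬ T (arc u v))
  where
  open Subdigraph H using (vertices; arc)
  open Digraph D using (_⟶_)

ThreeDicritical : Digraph → Set
ThreeDicritical D =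
  ¬ Dicolourable 2 (Digraph._⟶_ D) ×
  ((H : Subdigraph D) → Proper H → Dicolourable 2 (Subdigraph._⟶_ H))

loopless? : ∀ {n} (arc : Fin n → Fin n → Bool) → Dec (∀ v → ¬ T (arc v v))
loopless? arc = all? λ v → ¬? (T? (arc v v))

K↔ : ℕ → Digraph
K↔ n = record
  { order    = n
  ; arc      = λ u v → not ⌊ u ≟ v ⌋
  ; loopless = noLoop
  }
  where
  noLoop : (v : Fin n) → ¬ T (not ⌊ v ≟ v ⌋)
  noLoop v t with v ≟ v
  ... | yes _   = t
  ... | no  v≢v = v≢v refl

-- Arcs i → i + s on ℤₙ, for s in the given list.
circulantArc : (n : ℕ) .{{_ : NonZero n}} → List ℕ → Fin n → Fin n → Bool
circulantArc n ss i j = any (λ s → (toℕ i + s) % n ≡ᵇ toℕ j) ss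

C⃗₃ : Digraph
C⃗₃ = record
  { order    = 3
  ; arc      = circulantArc 3 (1 ∷ [])
  ; loopless = from-yes (loopless? (circulantArc 3 (1 ∷ [])))
  }

P₇ : Digraph
P₇ = record
  { order    = 7
  ; arc      = circulantArc 7 (1 ∷ 2 ∷ 4 ∷ [])
  ; loopless = from-yes (loopless? (circulantArc 7 (1 ∷ 2 ∷ 4 ∷ [])))
  }

listedArc : ∀ {n} → List (ℕ × ℕ) → Fin n → Fin n → Bool
listedArc as u v =
  any (λ (s , t) → (toℕ u ≡ᵇ s) ∧ (toℕ v ≡ᵇ t)) as

digon : ℕ → ℕ → List (ℕ × ℕ)
digon u v = (u , v) ∷ (v , u) ∷ []

-- The triangle is 0 → 1 → 2 → 0 and the vertex r is 3.
W⃗₃ : Digraph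
W⃗₃ = record
  { order    = 4
  ; arc      = listedArc as
  ; loopless = from-yes (loopless? {4} (listedArc as))
  }
  where
  as : List (ℕ × ℕ)
  as = (0 , 1) ∷ (1 , 2) ∷ (2 , 0) ∷ digon 3 0 ++ digon 3 1 ++ digon 3 2

H₅ : Digraph
H₅ = record
  { order    = 5
  ; arc      = listedArc as
  ; loopless = from-yes (loopless? {5} (listedArc as))
  }
  where
  as : List (ℕ × ℕ)
  as = digon 0 1 ++ digon 0 4 ++
       (4 , 1) ∷ (1 , 3) ∷ (1 , 2) ∷ (3 , 4) ∷ (2 , 4) ∷ (3 , 0) ∷ (0 , 2) ∷ (2 , 3) ∷ []

-- The vertex r is zero; the vertices suc x are those of H₁ followed by those of H₂.
ℛ : Digraph → Digraph → Digraph
ℛ H₁ H₂ = record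
  { order    = suc (order H₁ + order H₂)
  ; arc      = arcᴿ
  ; loopless = noLoop
  }
  where
  between : Vertex H₁ ⊎ Vertex H₂ → Vertex H₁ ⊎ Vertex H₂ → Bool
  between (inj₁ u) (inj₁ v) = Digraph.arc H₁ u v
  between (inj₁ _) (inj₂ _) = true
  between (inj₂ _) (inj₁ _) = false
  between (inj₂ u) (inj₂ v) = Digraph.arc H₂ u v

  fromRoot toRoot : Vertex H₁ ⊎ Vertex H₂ → Bool
  fromRoot (inj₁ _) = true
  fromRoot (inj₂ _) = false
  toRoot (inj₁ _) = false
  toRoot (inj₂ _) = true

  arcᴿ : Fin (suc (order H₁ + order H₂)) → Fin (suc (order H₁ + order H₂)) → Bool
  arcᴿ zero    zero    = false
  arcᴿ zero    (suc v) = fromRoot (splitAt (order H₁) v)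
  arcᴿ (suc u) zero    = toRoot (splitAt (order H₁) u)
  arcᴿ (suc u) (suc v) = between (splitAt (order H₁) u) (splitAt (order H₁) v)

  noLoop : ∀ v → ¬ T (arcᴿ v v)
  noLoop zero    ()
  noLoop (suc v) t with splitAt (order H₁) v
  ... | inj₁ u = Digraph.loopless H₁ u t
  ... | inj₂ u = Digraph.loopless H₂ u t

catalogue : Vec Digraph 8
catalogue =
  K↔ 3 ∷ W⃗₃ ∷ H₅ ∷
  ℛ (K↔ 2) (K↔ 2) ∷ ℛ (K↔ 2) C⃗₃ ∷ ℛ C⃗₃ (K↔ 2) ∷ ℛ C⃗₃ C⃗₃ ∷
  P₇ ∷ []

module Submission where

-- A 2-colouring of a semi-complete digraph is a dicolouring as soon as no digon
-- and no directed triangle is monochromatic.  If D is 3-dicritical, then for each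
-- arc uv a 2-dicolouring c of D − uv gives u and v the same colour, and (unless vu
-- is an arc) some w of that colour satisfies v → w → u; moreover c remains a
-- dicolouring after uv is replaced by vu, since a monochromatic u → z → v would
-- yield with w a monochromatic digon or triangle avoiding uv.  Conversely, this
-- replacement turns criticality of a semi-complete digraph into 2-colourability of
-- other semi-complete digraphs.
--
-- The classification grows an induced subdigraph of D one vertex at a time, keeping
-- for each of its arcs uv the list of colourings that the dicolouring chosen for uv
-- can restrict to; a branch dies when such a list is empty.  If some arc has no
-- witness w among the current vertices, w is added; otherwise any new vertex is.
-- When the subdigraph is not 2-colourable it contains a member of the catalogue,
-- and by criticality D is that member.  Starting from a digon, then (without digons)
-- from a transitive tournament on four vertices, and finally (excluding those too)
-- from the empty digraph, the search ends within eight vertices.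

open import Defs
open import Data.Bool using (Bool; true; false; T; not; _∧_; _∨_)
open import Data.Bool.ListAction using (any; all)
open import Data.Bool.Properties using (T?; ∧-identityʳ; ∨-identityʳ) renaming (_≟_ to _≟ᵇ_)
open import Data.Empty using (⊥; ⊥-elim)
open import Data.Fin using (Fin; zero; suc; _≟_)
open import Data.Fin.Permutation using (↔⇒≡)
open import Data.Fin.Properties using (all?; any?; ¬∀⟶∃¬; suc-injective)
open import Data.Fin.Subset using (⊤)
open import Data.Fin.Subset.Properties using (∈⊤)
open import Data.List
  using (List; []; _∷_; _∷ʳ_; _++_; concatMap;
         filterᵇ; null; cartesianProductWith; allFin)
  renaming (map to mapᴸ)
open import Data.List.Membership.Propositional using (_∈_; lose)
open import Data.List.Membership.Propositional.Properties
  using (∈-filter⁺; ∈-filter⁻; ∈-cartesianProductWith⁺; ∈-cartesianProductWith⁻; ∈-allFin)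
open import Data.List.Relation.Unary.All as All using (All; []; _∷_)
open import Data.List.Relation.Unary.All.Properties as All using ()
open import Data.List.Relation.Unary.AllPairs using ([]; _∷_)
open import Data.List.Relation.Unary.Any as Any using (here; there)
open import Data.List.Relation.Unary.Any.Properties as Any using ()
open import Data.List.Relation.Unary.Linked using (Linked; [-]; _∷_)
open import Data.Nat as ℕ using (ℕ; zero; suc)
open import Data.Product using (∃; ∃₂; _×_; _,_; proj₁; proj₂)
open import Data.Sum using (_⊎_; inj₁; inj₂)
open import Data.Unit using (tt)
open import Data.Vec as Vec using (Vec; []; _∷_; lookup; map; tabulate; _[_]≔_)
open import Data.Vec.Properties
  using (lookup-map; lookup-allFin; lookup∘tabulate; lookup∘update; lookup∘update′)
open import Function using (_∘_; id; Inverse; mk↔ₛ′)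
open import Level using (0ℓ)
open import Relation.Binary.Core using (Rel)
open import Relation.Binary.PropositionalEquality
  using (_≡_; _≢_; refl; sym; trans; cong; cong₂; subst)
open import Relation.Nullary using (¬_; Dec; yes; no; contradiction)
open import Relation.Nullary.Decidable
  using (⌊_⌋; toWitness; fromWitness; ¬?; _×-dec_; _⊎-dec_; _→-dec_; from-yes)

open Digraph using (order)

private variable
  n k m : ℕ
  V W   : Set

-- Booleans read as propositions

∧⁻ : ∀ x {y} → T (x ∧ y) → T x × T y
∧⁻ true t = tt , t

∧⁺ : ∀ x {y} → T x → T y → T (x ∧ y)
∧⁺ true _ t = t

∨⁻ : ∀ x {y} → T (x ∨ y) → T x ⊎ T y
∨⁻ true  t = inj₁ t
∨⁻ false t = inj₂ t

∨⁺₁ : ∀ x {y} → T x → T (x ∨ y)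
∨⁺₁ true t = t

∨⁺₂ : ∀ x {y} → T y → T (x ∨ y)
∨⁺₂ true  t = tt
∨⁺₂ false t = t

not⁻ : ∀ x → T (not x) → ¬ T x
not⁻ true  ()
not⁻ false _ ()

not⁺ : ∀ x → ¬ T x → T (not x)
not⁺ true  ¬t = ¬t tt
not⁺ false _  = tt

T⁺ : ∀ {x} → x ≡ true → T x
T⁺ refl = tt

T⇒true : ∀ x → T x → x ≡ true
T⇒true true _ = refl

¬T⇒false : ∀ x → ¬ T x → x ≡ false
¬T⇒false true  ¬t = contradiction tt ¬t
¬T⇒false false _  = refl

T-ext : ∀ {x y} → (T x → T y) → (T y → T x) → x ≡ y
T-ext {true}  {true}  _ _ = refl
T-ext {true}  {false} f _ = contradiction tt f
T-ext {false} {true}  _ g = contradiction tt g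
T-ext {false} {false} _ _ = refl

implies⁻ : ∀ a {b} → T (not a ∨ b) → T a → T b
implies⁻ true t _ = t

implies⁺ : ∀ a {b} → (T a → T b) → T (not a ∨ b)
implies⁺ true  f = f tt
implies⁺ false f = tt

-- Monochromatic triangles and dicolourings

BoolRel : Set → Set
BoolRel V = V → V → Bool

Loopless : BoolRel V → Set
Loopless R = ∀ v → ¬ T (R v v)

Semi : BoolRel V → Set
Semi R = ∀ u v → u ≢ v → T (R u v) ⊎ T (R v u)

-- A monochromatic directed triangle or, if y ≡ z, digon.
record Mono (R : BoolRel V) (c : V → Bool) (x y z : V) : Set where
  constructor mono
  field
    cxy : c x ≡ c y
    cxz : c x ≡ c z
    xy  : T (R x y)
    yz  : y ≡ z ⊎ T (R y z)
    zx  : T (R z x)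

Good : BoolRel V → (V → Bool) → Set
Good R c = ∀ {x y z} → ¬ Mono R c x y z

-- Contrapositively, good colourings pull back along homomorphisms, and this is how it is applied
-- throughout.
Mono-map : {R : BoolRel V} {S : BoolRel W} {d : V → Bool} {c : W → Bool} (h : V → W) →
           (∀ {i j} → T (R i j) → T (S (h i) (h j))) → (∀ i → d i ≡ c (h i)) →
           ∀ {i j l} → Mono R d i j l → Mono S c (h i) (h j) (h l)
Mono-map {R = R} {S} h hom d≗c {i} {j} {l} (mono cij cil ij jl li) =
  mono (trans (sym (d≗c i)) (trans cij (d≗c j))) (trans (sym (d≗c i)) (trans cil (d≗c l)))
       (hom ij) (jl′ jl) (hom li)
  where
  jl′ : j ≡ l ⊎ T (R j l) → h j ≡ h l ⊎ T (S (h j) (h l))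
  jl′ (inj₁ j≡l) = inj₁ (cong h j≡l)
  jl′ (inj₂ jl)  = inj₂ (hom jl)

-- A chord from the start of a cycle either closes a triangle or shortcuts the cycle.
good⇒acyclic : {R : BoolRel (Fin n)} → Loopless R → Semi R → {c : Fin n → Bool} → Good R c →
               {Q : Rel W 0ℓ} (π : W → Fin n) → (∀ {a b} → Q a b → T (R (π a) (π b))) →
               (∀ a b → c (π a) ≡ c (π b)) → Acyclic Q
good⇒acyclic {R = R} loopless semi {c} good {Q} π hom same cyc = go rest linked
  where
  open DirectedCycle cyc
  s = start

  walk : ∀ x xs → T (R (π s) (π x)) → ¬ Linked Q (x ∷ xs ∷ʳ s)
  walk x []       sx (xs ∷ [-]) = good (mono (same s x) (same s x) sx (inj₁ refl) (hom xs))
  walk x (y ∷ ys) sx (xy ∷ l) with π s ≟ π y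
  ... | yes s≡y = good (mono (same s x) (same s x) sx (inj₁ refl)
                             (subst (λ v → T (R (π x) v)) (sym s≡y) (hom xy)))
  ... | no  s≢y with semi (π s) (π y) s≢y
  ...   | inj₁ sy = walk y ys sy l
  ...   | inj₂ ys = good (mono (same s x) (same s y) sx (inj₂ (hom xy)) ys)

  go : ∀ xs → ¬ Linked Q (s ∷ xs ∷ʳ s)
  go []       (ss ∷ [-]) = loopless (π s) (hom ss)
  go (x ∷ xs) (sx ∷ l)   = walk x xs (hom sx) l

toBool : Fin 2 → Bool
toBool zero    = true
toBool (suc _) = false

fromBool : Bool → Fin 2
fromBool true  = zero
fromBool false = suc zero

toBool-injective : ∀ i j → toBool i ≡ toBool j → i ≡ j
toBool-injective zero       zero       _ = refl
toBool-injective (suc zero) (suc zero) _ = refl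

fromBool-injective : ∀ b c → fromBool b ≡ fromBool c → b ≡ c
fromBool-injective true  true  _ = refl
fromBool-injective false false _ = refl

-- `Q` need only map into `R`, so that a good colouring of one semi-complete digraph serves all its
-- subdigraphs, semi-complete or not.
good⇒dicolourable : {R : BoolRel (Fin n)} → Loopless R → Semi R → ∀ {c} → Good R c →
                    {Q : Rel W 0ℓ} (π : W → Fin n) → (∀ {a b} → Q a b → T (R (π a) (π b))) →
                    Dicolourable 2 Q
good⇒dicolourable loopless semi {c} good π hom =
  fromBool ∘ c ∘ π ,
  λ i → good⇒acyclic loopless semi good (π ∘ proj₁) hom
          λ (_ , p) (_ , q) → fromBool-injective _ _ (trans p (sym q))

-- A monochromatic digon or triangle is itself a directed cycle within a colour class; `σ` is
-- injective so that its vertices stay distinct.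
dicolourable⇒good : {R : BoolRel V} → Loopless R →
                    {Q : Rel W 0ℓ} (σ : V → W) → (∀ {x y} → σ x ≡ σ y → x ≡ y) →
                    (∀ {x y} → T (R x y) → Q (σ x) (σ y)) → Dicolourable 2 Q → ∃ (Good R)
dicolourable⇒good {R = R} loopless {Q} σ σ-inj hom (c , acyclic) = toBool ∘ c ∘ σ , good
  where
  distinct : ∀ {x y} → T (R x y) → x ≢ y
  distinct xy refl = loopless _ xy

  good : Good R (toBool ∘ c ∘ σ)
  good {x} {y} {z} (mono cxy cxz xy yz zx) = acyclic (c (σ x)) (cyc yz)
    where
    X : Set
    X = ∃ λ w → c w ≡ c (σ x)

    a b d : X
    a = σ x , refl
    b = σ y , sym (toBool-injective _ _ cxy)
    d = σ z , sym (toBool-injective _ _ cxz)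

    ≢-lift : ∀ {u v p q} → u ≢ v → _≢_ {A = X} (σ u , p) (σ v , q)
    ≢-lift u≢v eq = u≢v (σ-inj (cong proj₁ eq))

    cyc : y ≡ z ⊎ T (R y z) → DirectedCycle (Induced Q (λ w → c w ≡ c (σ x)))
    cyc (inj₁ refl) = record
      { start    = a
      ; rest     = b ∷ []
      ; distinct = (≢-lift (distinct xy) ∷ []) ∷ [] ∷ []
      ; linked   = hom xy ∷ hom zx ∷ [-]
      }
    cyc (inj₂ yz) = record
      { start    = a
      ; rest     = b ∷ d ∷ []
      ; distinct = (≢-lift (distinct xy) ∷ ≢-lift (distinct zx ∘ sym) ∷ [])
                 ∷ (≢-lift (distinct yz) ∷ []) ∷ [] ∷ []
      ; linked   = hom xy ∷ hom yz ∷ hom zx ∷ [-]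
      }

-- Cutting and reversing an arc

is : Fin n → Fin n → BoolRel (Fin n)
is u v a b = ⌊ a ≟ u ⌋ ∧ ⌊ b ≟ v ⌋

-- Reversal keeps a digraph semi-complete, so that good colourings of the result are dicolourings.
-- On one arc of a digon it amounts to deletion.
cut reverse : BoolRel (Fin n) → Fin n → Fin n → BoolRel (Fin n)
cut     R u v a b = R a b ∧ not (is u v a b)
reverse R u v a b = cut R u v a b ∨ is v u a b

is⁻ : ∀ {u v a b : Fin n} → T (is u v a b) → a ≡ u × b ≡ v
is⁻ {u = u} {v} {a} {b} t with p , q ← ∧⁻ ⌊ a ≟ u ⌋ t = toWitness p , toWitness q

is⁺ : ∀ (u v : Fin n) → T (is u v u v)
is⁺ u v = ∧⁺ ⌊ u ≟ u ⌋ (fromWitness refl) (fromWitness refl)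

module Cut {n} (R : BoolRel (Fin n)) (u v : Fin n) where

  cut⇒arc : ∀ {a b} → T (cut R u v a b) → T (R a b)
  cut⇒arc {a} {b} = proj₁ ∘ ∧⁻ (R a b)

  cut-misses : ¬ T (cut R u v u v)
  cut-misses t = not⁻ (is u v u v) (proj₂ (∧⁻ (R u v) t)) (is⁺ u v)

  arc⇒cut : ∀ {a b} → T (R a b) → ¬ (a ≡ u × b ≡ v) → T (cut R u v a b)
  arc⇒cut {a} {b} ab ≢uv = ∧⁺ (R a b) ab (not⁺ (is u v a b) (≢uv ∘ is⁻))

  cut⇒reverse : ∀ {a b} → T (cut R u v a b) → T (reverse R u v a b)
  cut⇒reverse {a} {b} = ∨⁺₁ (cut R u v a b)

  reverse⇒cut : ∀ {a b} → T (reverse R u v a b) → ¬ (a ≡ v × b ≡ u) → T (cut R u v a b)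
  reverse⇒cut {a} {b} ab ≢vu with ∨⁻ (cut R u v a b) ab
  ... | inj₁ t = t
  ... | inj₂ t = contradiction (is⁻ t) ≢vu

  reverse-misses : u ≢ v → ¬ T (reverse R u v u v)
  reverse-misses u≢v t = cut-misses (reverse⇒cut t (u≢v ∘ proj₁))

  reverse-flipped : T (reverse R u v v u)
  reverse-flipped = ∨⁺₂ (cut R u v v u) (is⁺ v u)

  reverse-loopless : Loopless R → T (R u v) → Loopless (reverse R u v)
  reverse-loopless loopless uv a aa =
    loopless a (cut⇒arc (reverse⇒cut aa λ { (refl , refl) → loopless a uv }))

  reverse-semi : Semi R → Semi (reverse R u v)
  reverse-semi semi a b a≢b with a ≟ u ×-dec b ≟ v | b ≟ u ×-dec a ≟ v | semi a b a≢b
  ... | yes (refl , refl) | _                 | _       = inj₂ reverse-flipped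
  ... | no _              | yes (refl , refl) | _       = inj₁ reverse-flipped
  ... | no ≢uv            | no _              | inj₁ ab = inj₁ (cut⇒reverse (arc⇒cut ab ≢uv))
  ... | no _              | no ≢uv            | inj₂ ba = inj₂ (cut⇒reverse (arc⇒cut ba ≢uv))

  reverse-elsewhere : ∀ {a b} → ¬ (a ≡ u × b ≡ v) → ¬ (a ≡ v × b ≡ u) → reverse R u v a b ≡ R a b
  reverse-elsewhere {a} {b} ≢uv ≢vu
    rewrite ¬T⇒false (is u v a b) (≢uv ∘ is⁻) | ¬T⇒false (is v u a b) (≢vu ∘ is⁻) =
    trans (∨-identityʳ _) (∧-identityʳ _)

-- Such a `c` will come from a 2-dicolouring of the digraph without `uv`; `witness` is then the rest
-- of a monochromatic digon or triangle that `uv` completes.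
record Splits (R : BoolRel (Fin n)) (u v : Fin n) (c : Fin n → Bool) : Set where
  field
    good    : Good (reverse R u v) c
    ends    : c u ≡ c v
    witness : T (R v u) ⊎ ∃ λ w → c w ≡ c u × T (R v w) × T (R w u)

mono? : (R : BoolRel (Fin n)) (c : Fin n → Bool) → ∀ x y z → Dec (Mono R c x y z)
mono? R c x y z with c x ≟ᵇ c y | c x ≟ᵇ c z | T? (R x y) | (y ≟ z) ⊎-dec (T? (R y z)) | T? (R z x)
... | yes p | yes q | yes r | yes s | yes t = yes (mono p q r s t)
... | no ¬p | _ | _ | _ | _ = no (¬p ∘ Mono.cxy)
... | _ | no ¬p | _ | _ | _ = no (¬p ∘ Mono.cxz)
... | _ | _ | no ¬p | _ | _ = no (¬p ∘ Mono.xy)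
... | _ | _ | _ | no ¬p | _ = no (¬p ∘ Mono.yz)
... | _ | _ | _ | _ | no ¬p = no (¬p ∘ Mono.zx)

module _ {R : BoolRel (Fin n)} (loopless : Loopless R) (semi : Semi R)
         (uncolourable : ∀ {c} → ¬ Good R c) {u v : Fin n} (uv : T (R u v))
         {c : Fin n → Bool} (good : Good (cut R u v) c) where

  open Cut R u v

  private
    monoEdge : ∃ λ x → ∃ λ y → ∃ λ z → Mono R c x y z
    monoEdge with any? (λ x → any? λ y → any? λ z → mono? R c x y z)
    ... | yes m  = m
    ... | no  ¬m = ⊥-elim (uncolourable {c} λ {x} {y} {z} m → ¬m (x , y , z , m))

    -- As `c` is good without `uv`, the monochromatic digon or triangle found in `R` runs through
    -- `uv`. The three tests ask which of its sides is `uv`; what remains of it is the witness.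
    found : c u ≡ c v × (T (R v u) ⊎ ∃ λ w → c w ≡ c u × T (R v w) × T (R w u))
    found with monoEdge
    ... | x , y , z , mono cxy cxz xy yz zx
      with x ≟ u ×-dec y ≟ v | y ≟ u ×-dec z ≟ v | z ≟ u ×-dec x ≟ v
    found | x , y , z , mono cxy cxz xy (inj₁ refl) zx | yes (refl , refl) | _ | _ =
      cxy , inj₁ zx
    found | x , y , z , mono cxy cxz xy (inj₂ yz) zx   | yes (refl , refl) | _ | _ =
      cxy , inj₂ (z , sym cxz , yz , zx)
    found | x , y , z , mono cxy cxz xy yz zx | no _ | yes (refl , refl) | _ =
      trans (sym cxy) cxz , inj₂ (x , cxy , zx , xy)
    found | x , y , z , mono cxy cxz xy (inj₁ refl) zx | no _ | no _ | yes (refl , refl) =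
      sym cxz , inj₁ xy
    found | x , y , z , mono cxy cxz xy (inj₂ yz) zx   | no _ | no _ | yes (refl , refl) =
      sym cxz , inj₂ (y , trans (sym cxy) cxz , xy , yz)
    found | x , y , z , mono cxy cxz xy (inj₁ refl) zx | no ¬xy | no _ | no ¬zx =
      ⊥-elim (good (mono cxy cxz (arc⇒cut xy ¬xy) (inj₁ refl) (arc⇒cut zx ¬zx)))
    found | x , y , z , mono cxy cxz xy (inj₂ yz) zx   | no ¬xy | no ¬yz | no ¬zx =
      ⊥-elim (good (mono cxy cxz (arc⇒cut xy ¬xy) (inj₂ (arc⇒cut yz ¬yz)) (arc⇒cut zx ¬zx)))

    u≢v : u ≢ v
    u≢v refl = loopless u uv

    -- If u → z → v and v → w → u are monochromatic, the pair w, z spans a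
    -- monochromatic digon or triangle avoiding the arc uv.
    unbridged : ∀ {z} → T (cut R u v u z) → T (cut R u v z v) → c z ≢ c u
    unbridged {z} uz zv cz with found
    ... | cuv , inj₁ vu =
      good (mono (sym cz) cuv uz (inj₂ zv) (arc⇒cut vu λ (v≡u , _) → u≢v (sym v≡u)))
    ... | cuv , inj₂ (w , cw , vw , wu) = finish (w ≟ z)
      where
      vw′ : T (cut R u v v w)
      vw′ = arc⇒cut vw λ (v≡u , _) → u≢v (sym v≡u)

      wu′ : T (cut R u v w u)
      wu′ = arc⇒cut wu λ (_ , u≡v) → u≢v u≡v

      finish : Dec (w ≡ z) → ⊥
      finish (yes refl) = good (mono (sym cz) (sym cz) uz (inj₁ refl) wu′)
      finish (no w≢z) with semi w z w≢z
      ... | inj₁ wz = good (mono (trans cw (sym cz)) (trans cw cuv)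
              (arc⇒cut wz λ { (refl , _) → loopless w wu }) (inj₂ zv) vw′)
      ... | inj₂ zw = good (mono (sym cz) (sym cw) uz
              (inj₂ (arc⇒cut zw λ { (refl , _) → loopless z (cut⇒arc uz) })) wu′)

    unbridgedʳ : ∀ {z} → T (reverse R u v u z) → T (reverse R u v z v) → c z ≢ c u
    unbridgedʳ uz zv = unbridged (reverse⇒cut uz λ (u≡v , _) → u≢v u≡v)
                                 (reverse⇒cut zv λ (_ , v≡u) → u≢v (sym v≡u))

    -- A monochromatic digon or triangle that avoids `vu` lies in the cut digraph. Through `vu`
    -- there is no digon, as `uv` is gone, and a triangle would contain a path u → z → v, which
    -- `unbridged` forbids.
    reverse-good : Good (reverse R u v) c
    reverse-good {x} {y} {z} (mono cxy cxz xy yz zx)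
      with x ≟ v ×-dec y ≟ u | y ≟ v ×-dec z ≟ u | z ≟ v ×-dec x ≟ u
    reverse-good (mono cxy cxz xy (inj₁ refl) zx) | yes (refl , refl) | _ | _ = reverse-misses u≢v zx
    reverse-good (mono cxy cxz xy (inj₂ yz) zx)   | yes (refl , refl) | _ | _ =
      unbridgedʳ yz zx (trans (sym cxz) cxy)
    reverse-good (mono cxy cxz xy yz zx) | no _ | yes (refl , refl) | _ = unbridgedʳ zx xy cxz
    reverse-good (mono cxy cxz xy (inj₁ refl) zx) | no _ | no _ | yes (refl , refl) = reverse-misses u≢v xy
    reverse-good (mono cxy cxz xy (inj₂ yz) zx)   | no _ | no _ | yes (refl , refl) =
      unbridgedʳ xy yz (sym cxy)
    reverse-good (mono cxy cxz xy (inj₁ refl) zx) | no ¬xy | no _ | no ¬zx =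
      good (mono cxy cxz (reverse⇒cut xy ¬xy) (inj₁ refl) (reverse⇒cut zx ¬zx))
    reverse-good (mono cxy cxz xy (inj₂ yz) zx)   | no ¬xy | no ¬yz | no ¬zx =
      good (mono cxy cxz (reverse⇒cut xy ¬xy) (inj₂ (reverse⇒cut yz ¬yz)) (reverse⇒cut zx ¬zx))

  cut-good⇒splits : Splits R u v c
  cut-good⇒splits = record { good = reverse-good ; ends = proj₁ found ; witness = proj₂ found }

-- Critical digraphs

record Critical (R : BoolRel (Fin n)) : Set where
  field
    loopless     : Loopless R
    semi         : Semi R
    uncolourable : ∀ {c} → ¬ Good R c
    cut-good     : ∀ {u v} → T (R u v) → ∃ (Good (cut R u v))

  splits : ∀ {u v} → T (R u v) → ∃ (Splits R u v)
  splits uv with c , good ← cut-good uv = c , cut-good⇒splits loopless semi uncolourable uv good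

dicritical⇒critical : ∀ D → SemiComplete D → ThreeDicritical D → Critical (Digraph.arc D)
dicritical⇒critical D semi (¬dicolourable , critical) = record
  { loopless     = loopless
  ; semi         = semi
  ; uncolourable = λ good → ¬dicolourable (good⇒dicolourable loopless semi good id id)
  ; cut-good     = λ {u} {v} uv →
      dicolourable⇒good {R = cut arc u v} (λ w → loopless w ∘ Cut.cut⇒arc arc u v)
        (_, ∈⊤) (cong proj₁) id
        (critical (deletion u v) (inj₂ (u , v , uv , Cut.cut-misses arc u v)))
  }
  where
  open Digraph D
  deletion : Vertex → Vertex → Subdigraph D
  deletion u v = record
    { vertices = ⊤
    ; arc      = cut arc u v
    ; arc⊆     = Cut.cut⇒arc arc u v
    ; source∈  = λ _ → ∈⊤
    ; target∈  = λ _ → ∈⊤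
    }

-- Since no vertex is a sink, a missing vertex entails a missing arc. A proper subdigraph therefore
-- lies in the reversal of some arc, which is semi-complete, and inherits its colouring.
critical⇒dicritical : ∀ D → Critical (Digraph.arc D) →
                      (∀ v → ∃ λ w → T (Digraph.arc D v w)) → ThreeDicritical D
critical⇒dicritical D critical noSink = ¬dicolourable , colour
  where
  open Digraph D
  open Critical critical hiding (loopless)
  ¬dicolourable : ¬ Dicolourable 2 _⟶_
  ¬dicolourable dic = uncolourable (proj₂ (dicolourable⇒good loopless id id id dic))

  colour : (H : Subdigraph D) → Proper H → Dicolourable 2 (Subdigraph._⟶_ H)
  colour H proper = without (missing proper)
    where
    module H = Subdigraph H

    missing : Proper H → ∃₂ λ u v → T (arc u v) × ¬ T (H.arc u v)
    missing (inj₁ (v , v∉H)) with w , vw ← noSink v = v , w , vw , v∉H ∘ H.source∈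
    missing (inj₂ p) = p

    without : (∃₂ λ u v → T (arc u v) × ¬ T (H.arc u v)) → Dicolourable 2 H._⟶_
    without (u , v , uv , ¬uv) with c , split ← splits uv =
      good⇒dicolourable (Cut.reverse-loopless arc u v loopless uv) (Cut.reverse-semi arc u v semi)
        (Splits.good split) proj₁
        λ ab → Cut.cut⇒reverse arc u v (Cut.arc⇒cut arc u v (H.arc⊆ ab) λ { (refl , refl) → ¬uv ab })

-- Patterns and their colourings

data Link : Set where
  fwd bwd both : Link

out inn : Link → Bool
out fwd  = true
out bwd  = false
out both = true
inn fwd  = false
inn bwd  = true
inn both = true

-- A semi-complete digraph; each row links a new vertex to the older ones.
infixr 5 _∷_
data Pattern : ℕ → Set where
  []  : Pattern 0
  _∷_ : Vec Link k → Pattern k → Pattern (suc k)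

arc : Pattern k → BoolRel (Fin k)
arc (ρ ∷ A) zero    zero    = false
arc (ρ ∷ A) zero    (suc j) = out (lookup ρ j)
arc (ρ ∷ A) (suc i) zero    = inn (lookup ρ i)
arc (ρ ∷ A) (suc i) (suc j) = arc A i j

-- With `ρ` and `σ` the rows of two adjacent vertices, this looks for a third vertex of colour `b`;
-- `p` and `q` fix the directions of its arcs so that a directed triangle results.
hits : (p q : Link → Bool) → Bool → Vec Link k → Vec Bool k → Vec Link k → Bool
hits p q b []      []       []      = false
hits p q b (r ∷ ρ) (c ∷ cs) (s ∷ σ) = (⌊ b ≟ᵇ c ⌋ ∧ (p r ∧ q s)) ∨ hits p q b ρ cs σ

-- Does colour b put the new vertex on a monochromatic digon or triangle?
blocked : Bool → Vec Link k → Vec Bool k → Pattern k → Bool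
blocked b []      []       []      = false
blocked b (r ∷ ρ) (c ∷ cs) (σ ∷ A) =
  (⌊ b ≟ᵇ c ⌋ ∧ ((out r ∧ (inn r ∨ hits inn out b ρ cs σ)) ∨ (inn r ∧ hits out inn b ρ cs σ)))
  ∨ blocked b ρ cs A

record Blocked (b : Bool) (ρ : Vec Link k) (cs : Vec Bool k) (A : Pattern k) : Set where
  constructor blockedAt
  field
    i j : Fin k
    bi  : b ≡ lookup cs i
    bj  : b ≡ lookup cs j
    xi  : T (out (lookup ρ i))
    ij  : i ≡ j ⊎ T (arc A i j)
    jx  : T (inn (lookup ρ j))

hits⁻ : ∀ (p q : Link → Bool) {b} (ρ : Vec Link k) cs σ → T (hits p q b ρ cs σ) →
        ∃ λ j → b ≡ lookup cs j × T (p (lookup ρ j)) × T (q (lookup σ j))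
hits⁻ p q []      []       []      ()
hits⁻ p q {b} (r ∷ ρ) (c ∷ cs) (s ∷ σ) t with ∨⁻ (⌊ b ≟ᵇ c ⌋ ∧ (p r ∧ q s)) t
... | inj₁ u with bc , pq ← ∧⁻ ⌊ b ≟ᵇ c ⌋ u = zero , toWitness bc , ∧⁻ (p r) pq
... | inj₂ u with j , at ← hits⁻ p q ρ cs σ u = suc j , at

hits⁺ : ∀ (p q : Link → Bool) {b} (ρ : Vec Link k) cs σ j →
        b ≡ lookup cs j → T (p (lookup ρ j)) → T (q (lookup σ j)) → T (hits p q b ρ cs σ)
hits⁺ p q {b} (r ∷ ρ) (c ∷ cs) (s ∷ σ) zero    bc pr qs =
  ∨⁺₁ (⌊ b ≟ᵇ c ⌋ ∧ (p r ∧ q s)) (∧⁺ ⌊ b ≟ᵇ c ⌋ (fromWitness bc) (∧⁺ (p r) pr qs))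
hits⁺ p q {b} (r ∷ ρ) (c ∷ cs) (s ∷ σ) (suc j) bc pr qs =
  ∨⁺₂ (⌊ b ≟ᵇ c ⌋ ∧ (p r ∧ q s)) (hits⁺ p q ρ cs σ j bc pr qs)

module _ (b : Bool) (r : Link) (ρ : Vec Link k) (c : Bool) (cs : Vec Bool k) (σ : Vec Link k) where

  viaOut viaInn atHead : Bool
  viaOut = out r ∧ (inn r ∨ hits inn out b ρ cs σ)
  viaInn = inn r ∧ hits out inn b ρ cs σ
  atHead = ⌊ b ≟ᵇ c ⌋ ∧ (viaOut ∨ viaInn)

  blocked⁻-head : (A : Pattern k) → T atHead → Blocked b (r ∷ ρ) (c ∷ cs) (σ ∷ A)
  blocked⁻-head A t with bc , u ← ∧⁻ ⌊ b ≟ᵇ c ⌋ t with ∨⁻ viaOut u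
  ... | inj₁ v with or , w ← ∧⁻ (out r) v with ∨⁻ (inn r) w
  ...   | inj₁ ir = blockedAt zero zero (toWitness bc) (toWitness bc) or (inj₁ refl) ir
  ...   | inj₂ h with j , bj , ij , oj ← hits⁻ inn out ρ cs σ h =
    blockedAt zero (suc j) (toWitness bc) bj or (inj₂ oj) ij
  blocked⁻-head A t | inj₂ v with ir , h ← ∧⁻ (inn r) v with j , bj , oj , ij ← hits⁻ out inn ρ cs σ h =
    blockedAt (suc j) zero bj (toWitness bc) oj (inj₂ ij) ir

blocked⁻ : ∀ b (ρ : Vec Link k) cs A → T (blocked b ρ cs A) → Blocked b ρ cs A
blocked⁻ b []      []       []      ()
blocked⁻ b (r ∷ ρ) (c ∷ cs) (σ ∷ A) t with ∨⁻ (atHead b r ρ c cs σ) t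
... | inj₁ u = blocked⁻-head b r ρ c cs σ A u
... | inj₂ u = later (blocked⁻ b ρ cs A u)
  where
  later : Blocked b ρ cs A → Blocked b (r ∷ ρ) (c ∷ cs) (σ ∷ A)
  later (blockedAt i j bi bj xi (inj₁ i≡j) jx) = blockedAt (suc i) (suc j) bi bj xi (inj₁ (cong suc i≡j)) jx
  later (blockedAt i j bi bj xi (inj₂ ij)  jx) = blockedAt (suc i) (suc j) bi bj xi (inj₂ ij) jx

blocked⁺ : ∀ b (ρ : Vec Link k) cs A → Blocked b ρ cs A → T (blocked b ρ cs A)
blocked⁺ b (r ∷ ρ) (c ∷ cs) (σ ∷ A) = split
  where
  now : b ≡ c → T (viaOut b r ρ c cs σ ∨ viaInn b r ρ c cs σ) → T (blocked b (r ∷ ρ) (c ∷ cs) (σ ∷ A))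
  now bc t = ∨⁺₁ (atHead b r ρ c cs σ) (∧⁺ ⌊ b ≟ᵇ c ⌋ (fromWitness bc) t)

  later : Blocked b ρ cs A → T (blocked b (r ∷ ρ) (c ∷ cs) (σ ∷ A))
  later B = ∨⁺₂ (atHead b r ρ c cs σ) (blocked⁺ b ρ cs A B)

  split : Blocked b (r ∷ ρ) (c ∷ cs) (σ ∷ A) → T (blocked b (r ∷ ρ) (c ∷ cs) (σ ∷ A))
  split (blockedAt zero    zero    bi bj xi _         jx) =
    now bi (∨⁺₁ (viaOut b r ρ c cs σ) (∧⁺ (out r) xi (∨⁺₁ (inn r) jx)))
  split (blockedAt zero    (suc j) bi bj xi (inj₂ ij) jx) =
    now bi (∨⁺₁ (viaOut b r ρ c cs σ) (∧⁺ (out r) xi (∨⁺₂ (inn r) (hits⁺ inn out ρ cs σ j bj jx ij))))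
  split (blockedAt (suc i) zero    bi bj xi (inj₂ ij) jx) =
    now bj (∨⁺₂ (viaOut b r ρ c cs σ) (∧⁺ (inn r) jx (hits⁺ out inn ρ cs σ i bi xi ij)))
  split (blockedAt (suc i) (suc j) bi bj xi (inj₁ i≡j) jx) =
    later (blockedAt i j bi bj xi (inj₁ (suc-injective i≡j)) jx)
  split (blockedAt (suc i) (suc j) bi bj xi (inj₂ ij) jx) =
    later (blockedAt i j bi bj xi (inj₂ ij) jx)

Colours : ℕ → Set
Colours k = List (Vec Bool k)

unblocked : Vec Link k → Pattern k → Vec Bool (suc k) → Bool
unblocked ρ A (b ∷ cs) = not (blocked b ρ cs A)

-- Only triangles and digons through the new vertex are tested: wherever this is used, `css`
-- consists of good colourings of `A`.
extend : Vec Link k → Pattern k → Colours k → Colours (suc k)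
extend ρ A css = filterᵇ (unblocked ρ A) (cartesianProductWith _∷_ (true ∷ false ∷ []) css)

colourings : Pattern k → Colours k
colourings []      = [] ∷ []
colourings (ρ ∷ A) = extend ρ A (colourings A)

GoodFor : Pattern k → Vec Bool k → Set
GoodFor A cs = Good (arc A) (lookup cs)

goodFor-tail : ∀ {ρ : Vec Link k} {A b cs} → GoodFor (ρ ∷ A) (b ∷ cs) → GoodFor A cs
goodFor-tail good m = good (Mono-map suc id (λ _ → refl) m)

∈-bools : ∀ b → b ∈ true ∷ false ∷ []
∈-bools true  = here refl
∈-bools false = there (here refl)

∈-extend⁺ : ∀ {ρ : Vec Link k} {A b cs css} → cs ∈ css → GoodFor (ρ ∷ A) (b ∷ cs) →
            b ∷ cs ∈ extend ρ A css
∈-extend⁺ {ρ = ρ} {A} {b} {cs} cs∈ good =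
  ∈-filter⁺ (T? ∘ unblocked ρ A) (∈-cartesianProductWith⁺ _∷_ (∈-bools b) cs∈)
    (not⁺ (blocked b ρ cs A) (absurd ∘ blocked⁻ b ρ cs A))
  where
  absurd : ¬ Blocked b ρ cs A
  absurd (blockedAt i j bi bj xi (inj₁ i≡j) jx) =
    good {zero} {suc i} {suc j} (mono bi bj xi (inj₁ (cong suc i≡j)) jx)
  absurd (blockedAt i j bi bj xi (inj₂ ij)  jx) =
    good {zero} {suc i} {suc j} (mono bi bj xi (inj₂ ij) jx)

colourings-complete : ∀ (A : Pattern k) cs → GoodFor A cs → cs ∈ colourings A
colourings-complete []      []       good = here refl
colourings-complete (ρ ∷ A) (b ∷ cs) good =
  ∈-extend⁺ (colourings-complete A cs (goodFor-tail {ρ = ρ} {A} {b} {cs} good)) good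

colourings-sound : ∀ (A : Pattern k) {cs} → cs ∈ colourings A → GoodFor A cs
colourings-sound (ρ ∷ A) {b ∷ cs} bcs∈ = good
  where
  filtered = ∈-filter⁻ (T? ∘ unblocked ρ A)
               {xs = cartesianProductWith _∷_ (true ∷ false ∷ []) (colourings A)} bcs∈

  cs∈ : cs ∈ colourings A
  cs∈ with ∈-cartesianProductWith⁻ _∷_ (true ∷ false ∷ []) (colourings A) (proj₁ filtered)
  ... | _ , _ , _ , cs∈ , refl = cs∈

  absurd : ¬ Blocked b ρ cs A
  absurd = not⁻ (blocked b ρ cs A) (proj₂ filtered) ∘ blocked⁺ b ρ cs A

  old : GoodFor A cs
  old = colourings-sound A cs∈

  good : GoodFor (ρ ∷ A) (b ∷ cs)
  -- A triangle through the new vertex is rotated until that vertex comes first, the position that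
  -- `Blocked` expects; all others lie in `A`.
  good {zero}  {suc j} {suc l} (mono p q r (inj₁ e) t) = absurd (blockedAt j l p q r (inj₁ (suc-injective e)) t)
  good {zero}  {suc j} {suc l} (mono p q r (inj₂ s) t) = absurd (blockedAt j l p q r (inj₂ s) t)
  good {suc i} {zero}  {zero}  (mono p q r (inj₁ e) t) = absurd (blockedAt i i (sym p) (sym p) t (inj₁ refl) r)
  good {suc i} {zero}  {suc l} (mono p q r (inj₂ s) t) =
    absurd (blockedAt l i (trans (sym p) q) (sym p) s (inj₂ t) r)
  good {suc i} {suc j} {zero}  (mono p q r (inj₂ s) t) =
    absurd (blockedAt i j (sym q) (trans (sym q) p) t (inj₂ r) s)
  good {suc i} {suc j} {suc l} (mono p q r (inj₁ e) t) = old (mono p q r (inj₁ (suc-injective e)) t)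
  good {suc i} {suc j} {suc l} (mono p q r (inj₂ s) t) = old (mono p q r (inj₂ s) t)

Realises : BoolRel V → Vec V k → Pattern k → Set
Realises R f A = ∀ i j → R (lookup f i) (lookup f j) ≡ arc A i j

Injective : Vec V k → Set
Injective f = ∀ i j → lookup f i ≡ lookup f j → i ≡ j

good⇒goodFor : ∀ {R : BoolRel V} {f : Vec V k} {A c} → Realises R f A → Good R c → GoodFor A (map c f)
good⇒goodFor {R = R} {f} {A} {c} r good m =
  good (Mono-map (lookup f) (λ {i} {j} → subst T (sym (r i j))) (λ i → lookup-map i c f) m)

-- The search

-- The arc from tail to head, the pattern with that arc reversed, and a list of
-- colourings to which some 2-colouring splitting that arc restricts.
record Fact (k : ℕ) : Set where
  constructor fact
  field
    tail head : Fin k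
    reversed  : Pattern k
    colours   : Colours k
open Fact

agree : Fin k → Fin k → Colours k → Colours k
agree i j = filterᵇ λ cs → ⌊ lookup cs i ≟ᵇ lookup cs j ⌋

-- `narrowed` is for a new vertex chosen as the witness of the fact's arc, which therefore has the
-- colour of the tail.
grown narrowed : Vec Link k → Fact k → Fact (suc k)
grown    ρ (fact u v A css) = fact (suc u) (suc v) (ρ ∷ A) (extend ρ A css)
narrowed ρ (fact u v A css) = fact (suc u) (suc v) (ρ ∷ A) (agree zero (suc u) (extend ρ A css))

when : {X : Set} → Bool → X → List X
when true  x = x ∷ []
when false x = []

-- The reversed arc has an end at the new vertex, so the older vertices still form `A` and its
-- colourings are the candidates to extend. The filter `agree` expresses `Splits.ends`.
newColours : Vec Link k → Pattern k → Colours k → Fin k → Link → Colours (suc k)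
newColours ρ A css i r = agree zero (suc i) (extend (ρ [ i ]≔ r) A css)

-- Reversing one arc of a digon deletes it, so the new link never depends on the old one.
outFact inFact : Vec Link k → Pattern k → Colours k → Fin k → Fact (suc k)
outFact ρ A css i = fact zero (suc i) ((ρ [ i ]≔ bwd) ∷ A) (newColours ρ A css i bwd)
inFact  ρ A css i = fact (suc i) zero ((ρ [ i ]≔ fwd) ∷ A) (newColours ρ A css i fwd)

newFacts : Vec Link k → Pattern k → Colours k → Fin k → List (Fact (suc k))
newFacts ρ A css i = when (out (lookup ρ i)) (outFact ρ A css i) ++ when (inn (lookup ρ i)) (inFact ρ A css i)

grownFacts : Vec Link k → Pattern k → List (Fact k) → List (Fact (suc k))
grownFacts {k} ρ A φs = mapᴸ (grown ρ) φs ++ concatMap (newFacts ρ A (colourings A)) (allFin k)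

factsOf : Pattern k → List (Fact k)
factsOf []      = []
factsOf (ρ ∷ A) = grownFacts ρ A (factsOf A)

-- When this is true, the witness of the arc lies outside the pattern, whichever of the listed
-- colourings is the actual one.
unwitnessed : Pattern k → Fact k → Bool
unwitnessed {k} A (fact u v _ css) =
  not (arc A v u) ∧
  not (any (λ i → (arc A v i ∧ arc A i u) ∧ any (λ cs → ⌊ lookup cs i ≟ᵇ lookup cs u ⌋) css) (allFin k))

rows : List Link → ∀ k → List (Vec Link k)
rows links zero    = [] ∷ []
rows links (suc k) = cartesianProductWith _∷_ links (rows links k)

closes : Vec Link k → Fact k → Bool
closes ρ φ = out (lookup ρ (tail φ)) ∧ inn (lookup ρ (head φ))

Closing : Set
Closing = ∀ {k} → Pattern k → Bool

-- In branch the second list holds the facts still to be tried; once it is exhausted, an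
-- arbitrary new vertex is added.
search : List Link → Closing → ℕ → Pattern k → List (Fact k) → Bool
branch : List Link → Closing → ℕ → Pattern k → List (Fact k) → List (Fact k) → Bool

search links closed zero    A φs = false
search links closed (suc m) A φs = any (null ∘ colours) φs ∨ (closed A ∨ branch links closed m A φs φs)

branch {k} links closed m A φs []       =
  not (null (colourings A)) ∧
  all (λ ρ → search links closed m (ρ ∷ A) (grownFacts ρ A φs)) (rows links k)
branch {k} links closed m A φs (φ ∷ ψs) =
  (unwitnessed A φ ∧
   all (λ ρ → not (closes ρ φ) ∨ search links closed m (ρ ∷ A) (narrowed ρ φ ∷ grownFacts ρ A φs))
       (rows links k))
  ∨ branch links closed m A φs ψs

-- Being a record, this type is compared by its parameters, without rerunning the search.
record Exhausted (links : List Link) (closed : Closing) (A : Pattern k) : Set where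
  constructor within
  field
    depth : ℕ
    found : search links closed depth A (factsOf A) ≡ true

∈-nonnull : {X : Set} {x : X} {xs : List X} → x ∈ xs → ¬ T (null xs)
∈-nonnull (here _)  ()
∈-nonnull (there _) ()

nonnull-∈ : {X : Set} {xs : List X} → ¬ T (null xs) → ∃ λ x → x ∈ xs
nonnull-∈ {xs = []}     ¬null = contradiction tt ¬null
nonnull-∈ {xs = x ∷ xs} _     = x , here refl

All-when : {X : Set} {P : X → Set} {x : X} → ∀ b → (T b → P x) → All P (when b x)
All-when true  p = p tt ∷ []
All-when false p = []

-- Soundness of the search

module _ {R : BoolRel (Fin n)} (critical : Critical R) where
  open Critical critical

  -- `colour` is defined on the whole digraph and stays fixed while the pattern grows; the list in
  -- `φ` merely confines its restriction.
  record Holds (f : Vec (Fin n) k) (φ : Fact k) : Set where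
    field
      colour   : Fin n → Bool
      splitting : Splits R (lookup f (tail φ)) (lookup f (head φ)) colour
      realises : Realises (reverse R (lookup f (tail φ)) (lookup f (head φ))) f (reversed φ)
      listed   : map colour f ∈ colours φ

  module _ {f : Vec (Fin n) k} {x : Fin n} {ρ : Vec Link k} {A : Pattern k}
           (realises : Realises R (x ∷ f) (ρ ∷ A)) (injective : Injective (x ∷ f)) where

    private
      x∉f : ∀ i → x ≢ lookup f i
      x∉f i x≡ with () ← injective zero (suc i) x≡

    -- The new vertex is neither end of the fact's arc, so reversing that arc leaves its row
    -- unchanged.
    grown-holds : ∀ {φ} → Holds f φ → Holds (x ∷ f) (grown ρ φ)
    grown-holds {φ} h = record
      { colour   = colour
      ; splitting = splitting
      ; realises = realises′
      ; listed   = ∈-extend⁺ {b = colour x} listed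
                     (good⇒goodFor {f = x ∷ f} {A = ρ ∷ reversed φ} realises′ (Splits.good splitting))
      }
      where
      open Holds h renaming (realises to old)
      u v : Fin n
      u = lookup f (tail φ)
      v = lookup f (head φ)
      x≢u = x∉f (tail φ)
      x≢v = x∉f (head φ)

      at-x : ∀ y → reverse R u v x y ≡ R x y
      at-x y = Cut.reverse-elsewhere R u v (x≢u ∘ proj₁) (x≢v ∘ proj₁)

      to-x : ∀ y → reverse R u v y x ≡ R y x
      to-x y = Cut.reverse-elsewhere R u v (x≢v ∘ proj₂) (x≢u ∘ proj₂)

      realises′ : Realises (reverse R u v) (x ∷ f) (ρ ∷ reversed φ)
      realises′ zero    zero    = trans (at-x x) (realises zero zero)
      realises′ zero    (suc j) = trans (at-x (lookup f j)) (realises zero (suc j))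
      realises′ (suc i) zero    = trans (to-x (lookup f i)) (realises (suc i) zero)
      realises′ (suc i) (suc j) = old i j

    -- `S` stands for the reversal of either arc between `x` and the vertex at `i`, which lets
    -- `outFact` and `inFact` share one argument.
    update-realises : ∀ {S : BoolRel (Fin n)} {i r} →
      S x (lookup f i) ≡ out r → S (lookup f i) x ≡ inn r →
      (∀ a b → ¬ (a ≡ x × b ≡ lookup f i) → ¬ (a ≡ lookup f i × b ≡ x) → S a b ≡ R a b) →
      Realises S (x ∷ f) ((ρ [ i ]≔ r) ∷ A)
    update-realises {S} {i} {r} xi ix elsewhere = go
      where
      fresh : ∀ {j} → j ≢ i → lookup f j ≢ lookup f i
      fresh j≢i = j≢i ∘ suc-injective ∘ injective (suc _) (suc i)

      go : Realises S (x ∷ f) ((ρ [ i ]≔ r) ∷ A)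
      go zero    zero    = trans (elsewhere x x (x∉f i ∘ proj₂) (x∉f i ∘ proj₁)) (realises zero zero)
      go zero    (suc j) with j ≟ i
      ... | yes refl = trans xi (cong out (sym (lookup∘update i ρ r)))
      ... | no  j≢i  = trans (elsewhere x (lookup f j) (fresh j≢i ∘ proj₂) (x∉f i ∘ proj₁))
                      (trans (realises zero (suc j)) (cong out (sym (lookup∘update′ j≢i ρ r))))
      go (suc j) zero    with j ≟ i
      ... | yes refl = trans ix (cong inn (sym (lookup∘update i ρ r)))
      ... | no  j≢i  = trans (elsewhere (lookup f j) x (x∉f i ∘ proj₂) (fresh j≢i ∘ proj₁))
                      (trans (realises (suc j) zero) (cong inn (sym (lookup∘update′ j≢i ρ r))))
      go (suc j) (suc l) = trans (elsewhere (lookup f j) (lookup f l)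
                                  (x∉f j ∘ sym ∘ proj₁) (x∉f l ∘ sym ∘ proj₂))
                                 (realises (suc j) (suc l))

    newColours-listed : ∀ {S : BoolRel (Fin n)} {i r c} → Realises S (x ∷ f) ((ρ [ i ]≔ r) ∷ A) →
      Good S c → c x ≡ c (lookup f i) → map c (x ∷ f) ∈ newColours ρ A (colourings A) i r
    newColours-listed {S} {i} {r} {c} real good eq =
      ∈-filter⁺ (λ cs → T? ⌊ lookup cs zero ≟ᵇ lookup cs (suc i) ⌋)
        (∈-extend⁺ {b = c x}
          (colourings-complete A (map c f)
            (goodFor-tail {ρ = ρ [ i ]≔ r} {A} {c x} {map c f} goodFor)) goodFor)
        (fromWitness (trans eq (sym (lookup-map i c f))))
      where
      goodFor : GoodFor ((ρ [ i ]≔ r) ∷ A) (c x ∷ map c f)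
      goodFor = good⇒goodFor {f = x ∷ f} {A = (ρ [ i ]≔ r) ∷ A} real good

    -- Here and in `inFact-holds` criticality enters the search: `splits` chooses the colouring to
    -- be followed for a new arc.
    outFact-holds : ∀ i → T (out (lookup ρ i)) → Holds (x ∷ f) (outFact ρ A (colourings A) i)
    outFact-holds i oi with c , split ← splits (subst T (sym (realises zero (suc i))) oi) = record
      { colour   = c
      ; splitting = split
      ; realises = real
      ; listed   = newColours-listed {r = bwd} real (Splits.good split) (Splits.ends split)
      }
      where
      y = lookup f i
      real : Realises (reverse R x y) (x ∷ f) ((ρ [ i ]≔ bwd) ∷ A)
      real = update-realises (¬T⇒false _ (Cut.reverse-misses R x y (x∉f i)))
               (T⇒true _ (Cut.reverse-flipped R x y))
               (λ a b → Cut.reverse-elsewhere R x y)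

    inFact-holds : ∀ i → T (inn (lookup ρ i)) → Holds (x ∷ f) (inFact ρ A (colourings A) i)
    inFact-holds i ii with c , split ← splits (subst T (sym (realises (suc i) zero)) ii) = record
      { colour   = c
      ; splitting = split
      ; realises = real
      ; listed   = newColours-listed {r = fwd} real (Splits.good split) (sym (Splits.ends split))
      }
      where
      y = lookup f i
      real : Realises (reverse R y x) (x ∷ f) ((ρ [ i ]≔ fwd) ∷ A)
      real = update-realises (T⇒true _ (Cut.reverse-flipped R y x))
               (¬T⇒false _ (Cut.reverse-misses R y x (x∉f i ∘ sym)))
               (λ a b ≢xy ≢yx → Cut.reverse-elsewhere R y x ≢yx ≢xy)

    grownFacts-hold : ∀ {φs} → All (Holds f) φs → All (Holds (x ∷ f)) (grownFacts ρ A φs)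
    grownFacts-hold hs =
      All.++⁺ (All.map⁺ (All.map (λ {φ} → grown-holds {φ}) hs))
              (All.concat⁺ (All.map⁺ (All.tabulate⁺ λ i →
                All.++⁺ (All-when (out (lookup ρ i)) (outFact-holds i))
                        (All-when (inn (lookup ρ i)) (inFact-holds i)))))

    narrowed-holds : ∀ {φ} (h : Holds f φ) → Holds.colour h x ≡ Holds.colour h (lookup f (tail φ)) →
                     Holds (x ∷ f) (narrowed ρ φ)
    narrowed-holds {φ} h eq = record
      { colour   = colour
      ; splitting = splitting
      ; realises = realises′
      ; listed   = ∈-filter⁺ (λ cs → T? ⌊ lookup cs zero ≟ᵇ lookup cs (suc (tail φ)) ⌋) listed
                     (fromWitness (trans eq (sym (lookup-map (tail φ) colour f))))
      }
      where open Holds (grown-holds h) renaming (realises to realises′)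

  factsOf-hold : ∀ {f : Vec (Fin n) k} A → Realises R f A → Injective f → All (Holds f) (factsOf A)
  factsOf-hold               []      _        _         = []
  factsOf-hold {f = x ∷ f} (ρ ∷ A) realises injective =
    grownFacts-hold realises injective
      (factsOf-hold A (λ i j → realises (suc i) (suc j))
                      (λ i j → suc-injective ∘ injective (suc i) (suc j)))

  -- `links` lists the ways in which two vertices can be joined, so that a digraph without digons is
  -- searched with `fwd` and `bwd` alone.
  module Soundness (links : List Link) (closed : Closing) {Goal : Set}
    (linked : ∀ x y → x ≢ y → ∃ λ r → r ∈ links × R x y ≡ out r × R y x ≡ inn r)
    (closed-sound : ∀ {k} {A : Pattern k} {f} → Realises R f A → T (closed A) → Goal)
    where

    row : (f : Vec (Fin n) k) (x : Fin n) → (∀ i → x ≢ lookup f i) →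
          ∃ λ ρ → ρ ∈ rows links k ×
                  ∀ i → R x (lookup f i) ≡ out (lookup ρ i) × R (lookup f i) x ≡ inn (lookup ρ i)
    row []      x x∉f = [] , here refl , λ ()
    row (y ∷ f) x x∉f with r , r∈ , at ← linked x y (x∉f zero) | ρ , ρ∈ , ats ← row f x (x∉f ∘ suc) =
      r ∷ ρ , ∈-cartesianProductWith⁺ _∷_ r∈ ρ∈ , λ { zero → at ; (suc i) → ats i }

    record NewVertex (f : Vec (Fin n) k) (A : Pattern k) (x : Fin n) : Set where
      field
        ρ         : Vec Link k
        ρ∈        : ρ ∈ rows links k
        realises  : Realises R (x ∷ f) (ρ ∷ A)
        injective : Injective (x ∷ f)

    newVertex : (f : Vec (Fin n) k) (A : Pattern k) → Realises R f A → Injective f →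
                ∀ {x} → (∀ i → x ≢ lookup f i) → NewVertex f A x
    newVertex f A realises injective {x} x∉f with ρ , ρ∈ , at ← row f x x∉f = record
      { ρ         = ρ
      ; ρ∈        = ρ∈
      ; realises  = λ
        { zero    zero    → ¬T⇒false _ (loopless x)
        ; zero    (suc j) → proj₁ (at j)
        ; (suc i) zero    → proj₂ (at i)
        ; (suc i) (suc j) → realises i j
        }
      ; injective = λ
        { zero    zero    _ → refl
        ; zero    (suc j) e → contradiction e (x∉f j)
        ; (suc i) zero    e → contradiction (sym e) (x∉f i)
        ; (suc i) (suc j) e → cong suc (injective i j e)
        }
      }

    -- If f met every vertex, a colouring of the pattern would colour R.
    outside : (f : Vec (Fin n) k) (A : Pattern k) → Realises R f A → ∀ {cs} → cs ∈ colourings A →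
              ∃ λ x → ∀ i → x ≢ lookup f i
    outside f A realises {cs} cs∈ with all? (λ x → any? λ i → x ≟ lookup f i)
    ... | no ¬onto
      with x , ¬i ← ¬∀⟶∃¬ n (λ x → ∃ λ i → x ≡ lookup f i) (λ x → any? λ i → x ≟ lookup f i) ¬onto =
      x , λ i x≡ → ¬i (i , x≡)
    ... | yes onto = ⊥-elim (uncolourable λ {x} {y} {z} m →
          colourings-sound A cs∈ (Mono-map (proj₁ ∘ onto) hom (λ _ → refl) m))
      where
      hom : ∀ {x y} → T (R x y) → T (arc A (proj₁ (onto x)) (proj₁ (onto y)))
      hom {x} {y} = subst T (trans (cong₂ R (proj₂ (onto x)) (proj₂ (onto y))) (realises _ _))

    -- Were the witness among the current vertices, the restriction of the colouring, being listed,
    -- would make the test `unwitnessed` fail; so would a digon on the arc.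
    newWitness : (f : Vec (Fin n) k) (A : Pattern k) {φ : Fact k} → Realises R f A → (h : Holds f φ) →
                 T (unwitnessed A φ) →
                 ∃ λ w → (∀ i → w ≢ lookup f i) × Holds.colour h w ≡ Holds.colour h (lookup f (tail φ)) ×
                         T (R (lookup f (head φ)) w) × T (R w (lookup f (tail φ)))
    newWitness {k} f A {φ} realises h t with ∧⁻ (not (arc A v u)) t
      where u = tail φ
            v = head φ
    ... | ¬vu , ¬any with Splits.witness (Holds.splitting h)
    ...   | inj₁ vu = contradiction (subst T (realises (head φ) (tail φ)) vu)
                                    (not⁻ (arc A (head φ) (tail φ)) ¬vu)
    ...   | inj₂ (w , cw , vw , wu) = w , w∉f , cw , vw , wu
      where
      open Holds h using (colour; listed)
      u v : Fin k
      u = tail φ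
      v = head φ

      witnesses : Fin k → Bool
      witnesses i = (arc A v i ∧ arc A i u) ∧ any (λ cs → ⌊ lookup cs i ≟ᵇ lookup cs u ⌋) (colours φ)

      w∉f : ∀ i → w ≢ lookup f i
      w∉f i refl = not⁻ (any witnesses (allFin k)) ¬any (Any.any⁺ witnesses (lose (∈-allFin i)
        (∧⁺ (arc A v i ∧ arc A i u)
          (∧⁺ (arc A v i) (subst T (realises v i) vw) (subst T (realises i u) wu))
          (Any.any⁺ (λ cs → ⌊ lookup cs i ≟ᵇ lookup cs u ⌋) (lose listed
            (fromWitness (trans (lookup-map i colour f) (trans cw (sym (lookup-map u colour f))))))))))

    -- Running out of depth answers `false`, so a true answer has closed every branch. An empty list
    -- of colours contradicts `Holds.listed`.
    search-sound : ∀ m {A : Pattern k} {f φs} → Realises R f A → Injective f → All (Holds f) φs →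
                   T (search links closed m A φs) → Goal
    branch-sound : ∀ m {A : Pattern k} {f φs} ψs → Realises R f A → Injective f →
                   All (Holds f) φs → All (Holds f) ψs → T (branch links closed m A φs ψs) → Goal

    search-sound (suc m) {A} {f} {φs} real inj hs t with ∨⁻ (any (null ∘ colours) φs) t
    ... | inj₁ u with h , null ← All.lookupAny hs (Any.any⁻ (null ∘ colours) φs u) =
      contradiction null (∈-nonnull (Holds.listed h))
    ... | inj₂ u with ∨⁻ (closed A) u
    ...   | inj₁ v = closed-sound {f = f} real v
    ...   | inj₂ v = branch-sound m φs real inj hs hs v

    branch-sound {k} m {A} {f} {φs} [] real inj hs _ t
      with ¬null , every ← ∧⁻ (not (null (colourings A))) t
      with cs , cs∈ ← nonnull-∈ (not⁻ (null (colourings A)) ¬null)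
      with x , x∉f ← outside f A real cs∈ =
      search-sound m realises injective (grownFacts-hold realises injective hs)
        (All.lookup (All.all⁺ (λ ρ → search links closed m (ρ ∷ A) (grownFacts ρ A φs))
                              (rows links k) every) ρ∈)
      where open NewVertex (newVertex f A real inj x∉f)
    branch-sound {k} m {A} {f} {φs} (φ ∷ ψs) real inj hs (h ∷ hs′) t
      with ∨⁻ (unwitnessed A φ ∧ all step (rows links k)) t
      where
      step : Vec Link k → Bool
      step ρ = not (closes ρ φ) ∨ search links closed m (ρ ∷ A) (narrowed ρ φ ∷ grownFacts ρ A φs)
    ... | inj₂ u = branch-sound m ψs real inj hs hs′ u
    ... | inj₁ u
      with unwit , every ← ∧⁻ (unwitnessed A φ) u
      with w , w∉f , cw , vw , wu ← newWitness f A real h unwit =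
      conclude (∨⁻ (not (closes ρ φ)) (All.lookup (All.all⁺ _ (rows links k) every) ρ∈))
      where
      open NewVertex (newVertex f A real inj w∉f)

      conclude : T (not (closes ρ φ)) ⊎
                 T (search links closed m (ρ ∷ A) (narrowed ρ φ ∷ grownFacts ρ A φs)) → Goal
      -- The search skips rows whose new vertex does not complete a directed triangle with the
      -- fact's arc; the row of `w` is not one of these.
      conclude (inj₁ ¬closes) = contradiction
        (∧⁺ (out (lookup ρ (tail φ))) (subst T (realises zero (suc (tail φ))) wu)
                                      (subst T (realises (suc (head φ)) zero) vw))
        (not⁻ (closes ρ φ) ¬closes)
      conclude (inj₂ found) =
        search-sound m realises injective
          (narrowed-holds realises injective h cw ∷ grownFacts-hold realises injective hs) found

    exhausted-sound : (A : Pattern k) (f : Vec (Fin n) k) → Realises R f A → Injective f →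
                      Exhausted links closed A → Goal
    exhausted-sound A f realises injective (within m found) =
      search-sound m {f = f} realises injective (factsOf-hold A realises injective) (T⁺ found)

-- Homomorphisms into patterns

-- For an unjoined pair `bwd` is a dummy value; the hypothesis of `link-inn` excludes that case.
link : Bool → Bool → Link
link true  true  = both
link true  false = fwd
link false _     = bwd

describe : BoolRel V → Vec V k → Pattern k
describe R []      = []
describe R (x ∷ f) = map (λ y → link (R x y) (R y x)) f ∷ describe R f

link-out : ∀ a b → a ≡ out (link a b)
link-out true  true  = refl
link-out true  false = refl
link-out false _     = refl

link-inn : ∀ a b → T a ⊎ T b → b ≡ inn (link a b)
link-inn true  true  _ = refl
link-inn true  false _ = refl
link-inn false true  _ = refl
link-inn false false (inj₁ ())
link-inn false false (inj₂ ())

describe-realises : {R : BoolRel V} → Loopless R → Semi R → (f : Vec V k) → Injective f →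
                    Realises R f (describe R f)
describe-realises {R = R} loopless semi (x ∷ f) inj = λ
  { zero    zero    → ¬T⇒false _ (loopless x)
  ; zero    (suc j) → trans (link-out _ _) (cong out (sym (lookup-map j links f)))
  ; (suc i) zero    → trans (link-inn _ _ (semi x (lookup f i) (fresh i)))
                            (cong inn (sym (lookup-map i links f)))
  ; (suc i) (suc j) → describe-realises loopless semi f (λ i j → suc-injective ∘ inj (suc i) (suc j)) i j
  }
  where
  links = λ y → link (R x y) (R y x)
  fresh : ∀ i → x ≢ lookup f i
  fresh i x≡ with () ← inj zero (suc i) x≡

-- Turns a whole semi-complete digraph into a pattern, so that its colourability is settled by
-- evaluating `colourings`.
matrix : BoolRel (Fin n) → Pattern n
matrix R = describe R (Vec.allFin _)

matrix-arc : {R : BoolRel (Fin n)} → Loopless R → Semi R → ∀ u v → R u v ≡ arc (matrix R) u v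
matrix-arc {R = R} loopless semi u v =
  trans (sym (cong₂ R (lookup-allFin u) (lookup-allFin v)))
        (describe-realises loopless semi (Vec.allFin _)
          (λ i j e → trans (sym (lookup-allFin i)) (trans e (lookup-allFin j))) u v)

matrix-uncolourable : {R : BoolRel (Fin n)} → Loopless R → Semi R → T (null (colourings (matrix R))) →
                      ∀ {c} → ¬ Good R c
matrix-uncolourable {R = R} loopless semi empty {c} good =
  ∈-nonnull (colourings-complete (matrix R) (tabulate c) λ m →
    good (Mono-map id (λ {i} {j} → subst T (sym (matrix-arc loopless semi i j))) (lookup∘tabulate c) m)) empty

matrix-colourable : {R : BoolRel (Fin n)} → Loopless R → Semi R → ¬ T (null (colourings (matrix R))) →
                    ∃ (Good R)
matrix-colourable {R = R} loopless semi nonempty with cs , cs∈ ← nonnull-∈ nonempty =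
  lookup cs , λ m → colourings-sound (matrix R) cs∈
    (Mono-map id (λ {i} {j} → subst T (matrix-arc loopless semi i j)) (λ _ → refl) m)

fits : Pattern k → Fin k → Vec Link m → Vec (Fin k) m → Bool
fits A i []      []      = true
fits A i (r ∷ ρ) (j ∷ φ) = ((not (out r) ∨ arc A i j) ∧ (not (inn r) ∨ arc A j i)) ∧ fits A i ρ φ

fitting : Pattern k → Vec Link m → Vec (Fin k) (suc m) → Bool
fitting A ρ (i ∷ φ) = fits A i ρ φ

-- These maps are automatically injective: any two vertices of `P` are joined, and the loopless `A`
-- offers no image for an arc whose ends are identified.
homs : Pattern k → Pattern m → List (Vec (Fin k) m)
homs     A []      = [] ∷ []
homs {k} A (ρ ∷ P) = filterᵇ (fitting A ρ) (cartesianProductWith _∷_ (allFin k) (homs A P))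

contains : Pattern k → Pattern m → Bool
contains A P = not (null (homs A P))

Hom : BoolRel V → (Fin m → V) → Pattern m → Set
Hom R φ P = ∀ i j → T (arc P i j) → T (R (φ i) (φ j))

fits⁻ : ∀ (A : Pattern k) i (ρ : Vec Link m) φ → T (fits A i ρ φ) → ∀ j →
        (T (out (lookup ρ j)) → T (arc A i (lookup φ j))) ×
        (T (inn (lookup ρ j)) → T (arc A (lookup φ j) i))
fits⁻ A i (r ∷ ρ) (j ∷ φ) t l
  with u , v ← ∧⁻ ((not (out r) ∨ arc A i j) ∧ (not (inn r) ∨ arc A j i)) t
  with l
... | zero  with o , i′ ← ∧⁻ (not (out r) ∨ arc A i j) u = implies⁻ (out r) o , implies⁻ (inn r) i′
... | suc l = fits⁻ A i ρ φ v l

fits⁺ : ∀ (A : Pattern k) i (ρ : Vec Link m) φ →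
        (∀ j → (T (out (lookup ρ j)) → T (arc A i (lookup φ j))) ×
               (T (inn (lookup ρ j)) → T (arc A (lookup φ j) i))) →
        T (fits A i ρ φ)
fits⁺ A i []      []      _ = tt
fits⁺ A i (r ∷ ρ) (j ∷ φ) h =
  ∧⁺ ((not (out r) ∨ arc A i j) ∧ (not (inn r) ∨ arc A j i))
     (∧⁺ (not (out r) ∨ arc A i j) (implies⁺ (out r) (proj₁ (h zero))) (implies⁺ (inn r) (proj₂ (h zero))))
     (fits⁺ A i ρ φ (h ∘ suc))

arc-irrefl : (A : Pattern k) → Loopless (arc A)
arc-irrefl (ρ ∷ A) (suc i) = arc-irrefl A i

homs-sound : ∀ (A : Pattern k) (P : Pattern m) {φ} → φ ∈ homs A P → Hom (arc A) (lookup φ) P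
homs-sound {k} A (ρ ∷ P) {i ∷ φ} iφ∈ = hom
  where
  candidates = cartesianProductWith _∷_ (allFin k) (homs A P)
  filtered   = ∈-filter⁻ (T? ∘ fitting A ρ) {xs = candidates} iφ∈

  φ∈ : φ ∈ homs A P
  φ∈ with ∈-cartesianProductWith⁻ _∷_ (allFin k) (homs A P) (proj₁ filtered)
  ... | _ , _ , _ , φ∈ , refl = φ∈

  hom : Hom (arc A) (lookup (i ∷ φ)) (ρ ∷ P)
  hom zero    (suc j) = proj₁ (fits⁻ A i ρ φ (proj₂ filtered) j)
  hom (suc j) zero    = proj₂ (fits⁻ A i ρ φ (proj₂ filtered) j)
  hom (suc j) (suc l) = homs-sound A P φ∈ j l

homs-complete : ∀ (A : Pattern k) (P : Pattern m) φ → Hom (arc A) (lookup φ) P → φ ∈ homs A P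
homs-complete A []      []      hom = here refl
homs-complete A (ρ ∷ P) (i ∷ φ) hom =
  ∈-filter⁺ (T? ∘ fitting A ρ)
    (∈-cartesianProductWith⁺ _∷_ (∈-allFin i) (homs-complete A P φ λ j l → hom (suc j) (suc l)))
    (fits⁺ A i ρ φ λ j → hom zero (suc j) , hom (suc j) zero)

contains⁻ : ∀ (A : Pattern k) (P : Pattern m) → T (contains A P) →
            ∃ λ (φ : Vec (Fin k) m) → Hom (arc A) (lookup φ) P
contains⁻ A P t with φ , φ∈ ← nonnull-∈ (not⁻ (null (homs A P)) t) = φ , homs-sound A P φ∈

contains⁺ : ∀ (A : Pattern k) (P : Pattern m) φ → Hom (arc A) (lookup φ) P → T (contains A P)
contains⁺ A P φ hom = not⁺ (null (homs A P)) (∈-nonnull (homs-complete A P φ hom))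

-- Embeddings between critical digraphs

vertexOf : ∀ n {R : BoolRel (Fin n)} → (∀ {c} → ¬ Good R c) → Fin n
-- The empty digraph has a good colouring vacuously.
vertexOf zero    uncolourable = ⊥-elim (uncolourable {λ ()} λ { {()} })
vertexOf (suc n) _            = zero

module Embedding {D E : Digraph}
                 (D-critical : Critical (Digraph.arc D)) (E-critical : Critical (Digraph.arc E))
                 (φ : Fin (order E) → Fin (order D))
                 (hom : ∀ {i j} → T (Digraph.arc E i j) → T (Digraph.arc D (φ i) (φ j))) where
  private
    module D = Digraph D
    module E = Digraph E
    module CD = Critical D-critical
    module CE = Critical E-critical

  φ-injective : ∀ i j → φ i ≡ φ j → i ≡ j
  φ-injective i j φi≡φj with i ≟ j
  ... | yes i≡j = i≡j
  ... | no  i≢j with CE.semi i j i≢j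
  ...   | inj₁ ij = ⊥-elim (D.loopless (φ i) (subst (λ v → T (D.arc (φ i) v)) (sym φi≡φj) (hom ij)))
  ...   | inj₂ ji = ⊥-elim (D.loopless (φ i) (subst (λ v → T (D.arc v (φ i))) (sym φi≡φj) (hom ji)))

  -- If the arc `ab` were missed, `E` would still map into `D` without `ab`, and a good colouring of
  -- the latter would pull back to `E`.
  arc-image : ∀ {a b} → T (D.arc a b) → ∃₂ λ i j → T (E.arc i j) × φ i ≡ a × φ j ≡ b
  arc-image {a} {b} ab with any? (λ i → any? λ j → T? (E.arc i j) ×-dec (φ i ≟ a ×-dec φ j ≟ b))
  ... | yes found = found
  ... | no ¬found with c , good ← CD.cut-good ab = ⊥-elim (CE.uncolourable λ m →
    good (Mono-map φ (λ {i} {j} ij → Cut.arc⇒cut D.arc a b (hom ij)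
                        λ (φi≡a , φj≡b) → ¬found (i , j , ij , φi≡a , φj≡b)) (λ _ → refl) m))

  -- A vertex other than a fixed image vertex is joined to it by some arc, which has a preimage by
  -- `arc-image`.
  onto : ∀ v → ∃ λ i → φ i ≡ v
  onto v with vertexOf (order E) CE.uncolourable
  ... | i₀ with φ i₀ ≟ v
  ...   | yes φi₀≡v = i₀ , φi₀≡v
  ...   | no  φi₀≢v with CD.semi (φ i₀) v φi₀≢v
  ...     | inj₁ e with _ , j , _ , _ , φj≡v ← arc-image e = j , φj≡v
  ...     | inj₂ e with i , _ , _ , φi≡v , _ ← arc-image e = i , φi≡v

  iso : D ≅ E
  iso = record
    { vertices = mk↔ₛ′ to φ (λ i → φ-injective _ _ (proj₂ (onto (φ i)))) (proj₂ ∘ onto)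
    ; arcs     = λ u v → T-ext
        (subst T (cong₂ D.arc (proj₂ (onto u)) (proj₂ (onto v))) ∘ hom)
        (pull u v)
    }
    where
    to : Fin (order D) → Fin (order E)
    to = proj₁ ∘ onto

    pull : ∀ u v → T (D.arc u v) → T (E.arc (to u) (to v))
    pull u v uv with i , j , ij , φi≡u , φj≡v ← arc-image uv =
      subst T (cong₂ E.arc (φ-injective _ _ (trans φi≡u (sym (proj₂ (onto u)))))
                           (φ-injective _ _ (trans φj≡v (sym (proj₂ (onto v)))))) ij

-- The catalogue

patternOf : (D : Digraph) → Pattern (order D)
patternOf D = matrix (Digraph.arc D)

-- `Reversible` reverses arcs where criticality deletes them, because a deletion may leave a pair
-- unjoined, which no `Pattern` can express. Colourings of the reversal remain good for the
-- deletion.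
Uncolourable Reversible NoSink : Digraph → Set
Uncolourable D = T (null (colourings (patternOf D)))
Reversible   D = ∀ u v → T (Digraph.arc D u v) →
                 ¬ T (null (colourings (matrix (reverse (Digraph.arc D) u v))))
NoSink       D = ∀ v → ∃ λ w → T (Digraph.arc D v w)

certified : ∀ D → SemiComplete D → Uncolourable D → Reversible D → Critical (Digraph.arc D)
certified D semi uncolourable reversible = record
  { loopless     = loopless
  ; semi         = semi
  ; uncolourable = matrix-uncolourable loopless semi uncolourable
  ; cut-good     = cut-good
  }
  where
  open Digraph D renaming (arc to R)

  cut-good : ∀ {u v} → T (R u v) → ∃ (Good (cut R u v))
  cut-good {u} {v} uv
    with c , good ← matrix-colourable {R = reverse R u v} (Cut.reverse-loopless R u v loopless uv)
                      (Cut.reverse-semi R u v semi) (reversible u v uv) =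
    c , λ m → good (Mono-map id (Cut.cut⇒reverse R u v) (λ _ → refl) m)

member : Fin 8 → Digraph
member = lookup catalogue

member-semi : ∀ i → SemiComplete (member i)
member-semi = from-yes (all? λ i → semi? (member i))
  where
  semi? : ∀ D → Dec (SemiComplete D)
  semi? D = all? λ u → all? λ v → ¬? (u ≟ v) →-dec (T? (Digraph.arc D u v) ⊎-dec T? (Digraph.arc D v u))

member-noSink : ∀ i → NoSink (member i)
member-noSink = from-yes (all? λ i → noSink? (member i))
  where
  noSink? : ∀ D → Dec (NoSink D)
  noSink? D = all? λ v → any? λ w → T? (Digraph.arc D v w)

member-uncolourable : ∀ i → Uncolourable (member i)
member-uncolourable = from-yes (all? λ i → uncolourable? (member i))
  where
  uncolourable? : ∀ D → Dec (Uncolourable D)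
  uncolourable? D = T? (null (colourings (patternOf D)))

member-reversible : ∀ i → Reversible (member i)
member-reversible = from-yes (all? λ i → reversible? (member i))
  where
  reversible? : ∀ D → Dec (Reversible D)
  reversible? D = all? λ u → all? λ v →
    T? (Digraph.arc D u v) →-dec ¬? (T? (null (colourings (matrix (reverse (Digraph.arc D) u v)))))

member-critical : ∀ i → Critical (Digraph.arc (member i))
member-critical i =
  certified (member i) (member-semi i) (member-uncolourable i) (member-reversible i)

-- Classification by three searches

embedded⇒≅ : ∀ D E → Critical (Digraph.arc D) → Critical (Digraph.arc E) →
             (A : Pattern k) (f : Vec (Fin (order D)) k) → Realises (Digraph.arc D) f A →
             T (contains A (patternOf E)) → D ≅ E
embedded⇒≅ D E criticalD criticalE A f realises t with φ , hom ← contains⁻ A (patternOf E) t =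
  Embedding.iso {D} {E} criticalD criticalE (lookup f ∘ lookup φ) λ {u} {v} uv →
    subst T (sym (realises (lookup φ u) (lookup φ v)))
      (hom u v (subst T (matrix-arc (Digraph.loopless E) (Critical.semi criticalE) u v) uv))

-- The colour test is a filter ahead of the enumeration of maps; every pattern that contains a
-- member of the catalogue passes it.
matches : Pattern k → Bool
matches A = null (colourings A) ∧ any (λ i → contains A (patternOf (member i))) (allFin 8)

matches-sound : ∀ D → Critical (Digraph.arc D) → {A : Pattern k} (f : Vec (Fin (order D)) k) →
                Realises (Digraph.arc D) f A → T (matches A) → ∃ λ i → D ≅ member i
matches-sound D critical {A} f realises t
  with i , ti ← Any.satisfied (Any.any⁻ (λ i → contains A (patternOf (member i))) (allFin 8)
                                (proj₂ (∧⁻ (null (colourings A)) t))) =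
  i , embedded⇒≅ D (member i) critical (member-critical i) A f realises ti

-- Arcs run from older to newer vertices, so index 3 is the source of `TT₄`. In `TT₄⁺` the two
-- oldest vertices form a digon that dominates an arc.
TT₄ TT₄⁺ : Pattern 4
TT₄  = (bwd ∷ bwd ∷ bwd ∷ []) ∷ (bwd ∷ bwd ∷ [])  ∷ (bwd ∷ []) ∷ [] ∷ []
TT₄⁺ = (bwd ∷ bwd ∷ bwd ∷ []) ∷ (bwd ∷ bwd ∷ [])  ∷ (both ∷ []) ∷ [] ∷ []

K₂ : Pattern 2
K₂ = (both ∷ []) ∷ [] ∷ []

K₂-search : Exhausted (fwd ∷ bwd ∷ both ∷ []) matches K₂
K₂-search = within 8 refl

TT₄-search : Exhausted (fwd ∷ bwd ∷ []) matches TT₄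
TT₄-search = within 8 refl

-- A branch containing `TT₄` may be closed at once, as `TT₄-search` accounts for the digraphs it
-- leads to.
matchesOrTT₄ : Pattern k → Bool
matchesOrTT₄ A = contains A TT₄ ∨ matches A

-- The starting pattern counts as a level, so depth 8 reaches seven vertices. Six would not suffice:
-- `P₇` contains no `TT₄`, and by criticality its patterns on fewer vertices are colourable.
TT₄-free-search : Exhausted (fwd ∷ bwd ∷ []) matchesOrTT₄ []
TT₄-free-search = within 8 refl

TT₄-tournament : ∀ i j → i ≡ j ⊎ T (arc TT₄ i j) ⊎ (T (arc TT₄ j i) × ¬ T (arc TT₄ i j))
TT₄-tournament = from-yes (all? λ i → all? λ j →
  i ≟ j ⊎-dec (T? (arc TT₄ i j) ⊎-dec (T? (arc TT₄ j i) ×-dec ¬? (T? (arc TT₄ i j)))))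

module Classify (D : Digraph) (critical : Critical (Digraph.arc D)) where
  open Critical critical
  private
    R = Digraph.arc D
    Goal = ∃ λ i → D ≅ member i

  digon-case : ∀ x y → T (R x y) → T (R y x) → Goal
  digon-case x y xy yx =
    Soundness.exhausted-sound critical (fwd ∷ bwd ∷ both ∷ []) matches linked
      (λ {_} {_} {f} → matches-sound D critical f) K₂ f realises injective K₂-search
    where
    linked : ∀ x y → x ≢ y → ∃ λ r → r ∈ fwd ∷ bwd ∷ both ∷ [] × R x y ≡ out r × R y x ≡ inn r
    linked x y x≢y = link (R x y) (R y x) , listed _ , link-out _ _ , link-inn _ _ (semi x y x≢y)
      where
      listed : ∀ r → r ∈ fwd ∷ bwd ∷ both ∷ []
      listed fwd  = here refl
      listed bwd  = there (here refl)
      listed both = there (there (here refl))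

    f : Vec (Fin (order D)) 2
    f = x ∷ y ∷ []

    realises : Realises R f K₂
    realises zero       zero       = ¬T⇒false _ (loopless x)
    realises zero       (suc zero) = T⇒true _ xy
    realises (suc zero) zero       = T⇒true _ yx
    realises (suc zero) (suc zero) = ¬T⇒false _ (loopless y)

    injective : Injective f
    injective zero       zero       _    = refl
    injective zero       (suc zero) refl = ⊥-elim (loopless x xy)
    injective (suc zero) zero       refl = ⊥-elim (loopless x xy)
    injective (suc zero) (suc zero) _    = refl

  module _ (oriented : ∀ x y → T (R x y) → ¬ T (R y x)) where

    linked : ∀ x y → x ≢ y → ∃ λ r → r ∈ fwd ∷ bwd ∷ [] × R x y ≡ out r × R y x ≡ inn r
    linked x y x≢y with semi x y x≢y
    ... | inj₁ xy = fwd , here refl , T⇒true _ xy , ¬T⇒false _ (oriented x y xy)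
    ... | inj₂ yx = bwd , there (here refl) , ¬T⇒false _ (oriented y x yx) , T⇒true _ yx

    -- Without digons, each arc of the image excludes its reverse, so a homomorphic copy of a
    -- tournament is an induced one.
    TT₄-case : (f : Vec (Fin (order D)) 4) → Hom R (lookup f) TT₄ → Goal
    TT₄-case f hom =
      Soundness.exhausted-sound critical (fwd ∷ bwd ∷ []) matches linked
        (λ {_} {_} {f} → matches-sound D critical f) TT₄ f realises injective TT₄-search
      where
      realises : Realises R f TT₄
      realises i j with TT₄-tournament i j
      ... | inj₁ refl             =
        trans (¬T⇒false _ (loopless (lookup f i))) (sym (¬T⇒false _ (arc-irrefl TT₄ i)))
      ... | inj₂ (inj₁ ij)        = trans (T⇒true _ (hom i j ij)) (sym (T⇒true _ ij))
      ... | inj₂ (inj₂ (ji , ¬ij)) = trans (¬T⇒false _ (oriented _ _ (hom j i ji))) (sym (¬T⇒false _ ¬ij))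

      injective : Injective f
      injective i j fi≡fj with TT₄-tournament i j
      ... | inj₁ i≡j             = i≡j
      ... | inj₂ (inj₁ ij)       = ⊥-elim (loopless _ (subst (λ v → T (R v (lookup f j))) fi≡fj (hom i j ij)))
      ... | inj₂ (inj₂ (ji , _)) = ⊥-elim (loopless _ (subst (λ v → T (R (lookup f j) v)) fi≡fj (hom j i ji)))

    oriented-case : Goal
    oriented-case =
      Soundness.exhausted-sound critical (fwd ∷ bwd ∷ []) matchesOrTT₄ linked
        (λ {_} {A} {f} → closed {A = A} f)
        [] [] (λ ()) (λ ()) TT₄-free-search
      where
      closed : {A : Pattern k} (f : Vec (Fin (order D)) k) → Realises R f A → T (matchesOrTT₄ A) → Goal
      closed {A = A} f realises t with ∨⁻ (contains A TT₄) t
      ... | inj₂ u = matches-sound D critical f realises u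
      ... | inj₁ u with φ , hom ← contains⁻ A TT₄ u =
        TT₄-case (map (lookup f) φ) λ i j ij →
          subst T (sym (trans (cong₂ R (lookup-map i (lookup f) φ) (lookup-map j (lookup f) φ))
                              (realises _ _)))
            (hom i j ij)

  classify : Goal
  classify with any? (λ x → any? λ y → T? (R x y) ×-dec T? (R y x))
  ... | yes (x , y , xy , yx) = digon-case x y xy yx
  ... | no ¬digon             = oriented-case λ x y xy yx → ¬digon (x , y , xy , yx)

-- Telling the members of the catalogue apart

module _ (D E : Digraph) (semiD : SemiComplete D) (semiE : SemiComplete E) (P : Pattern m) where
  private
    module D = Digraph D
    module E = Digraph E

  contains-map : (h : D.Vertex → E.Vertex) → (∀ u v → T (D.arc u v) → T (E.arc (h u) (h v))) →
                 T (contains (patternOf D) P) → T (contains (patternOf E) P)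
  contains-map h hom t with φ , homφ ← contains⁻ (patternOf D) P t =
    contains⁺ (patternOf E) P (map h φ) λ a b ab →
      subst T (sym (cong₂ (arc (patternOf E)) (lookup-map a h φ) (lookup-map b h φ)))
        (subst T (matrix-arc E.loopless semiE _ _)
          (hom _ _ (subst T (sym (matrix-arc D.loopless semiD _ _)) (homφ a b ab))))

contains-≅ : ∀ D E → SemiComplete D → SemiComplete E → (P : Pattern m) → D ≅ E →
             contains (patternOf D) P ≡ contains (patternOf E) P
contains-≅ D E semiD semiE P iso =
  T-ext (contains-map D E semiD semiE P to λ u v → subst T (sym (arcs u v)))
        (contains-map E D semiE semiD P from λ u v →
          subst T (trans (sym (cong₂ (Digraph.arc E) (strictlyInverseˡ u) (strictlyInverseˡ v))) (arcs _ _)))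
  where
  open _≅_ iso
  open Inverse vertices using (to; from; strictlyInverseˡ)

-- TT₄ occurs in ℛ C⃗₃ C⃗₃ but not in P₇; TT₄⁺ occurs in ℛ (K↔ 2) (K↔ 2) but not
-- in H₅, and in ℛ (K↔ 2) C⃗₃ but not in ℛ C⃗₃ (K↔ 2).
SameInvariants : Digraph → Digraph → Set
SameInvariants D E =
  order D ≡ order E ×
  contains (patternOf D) TT₄ ≡ contains (patternOf E) TT₄ ×
  contains (patternOf D) TT₄⁺ ≡ contains (patternOf E) TT₄⁺

member-distinct : ∀ i j → SameInvariants (member i) (member j) → i ≡ j
member-distinct = from-yes (all? λ i → all? λ j → sameInvariants? (member i) (member j) →-dec (i ≟ j))
  where
  sameInvariants? : ∀ D E → Dec (SameInvariants D E)
  sameInvariants? D E =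
    (order D ℕ.≟ order E) ×-dec
    ((contains (patternOf D) TT₄ ≟ᵇ contains (patternOf E) TT₄) ×-dec
     (contains (patternOf D) TT₄⁺ ≟ᵇ contains (patternOf E) TT₄⁺))

≅⇒sameInvariants : ∀ D E → SemiComplete D → SemiComplete E → D ≅ E → SameInvariants D E
≅⇒sameInvariants D E semiD semiE iso =
  ↔⇒≡ (_≅_.vertices iso) ,
  contains-≅ D E semiD semiE TT₄ iso ,
  contains-≅ D E semiD semiE TT₄⁺ iso

theorem10 : ((i : Fin 8) → SemiComplete (lookup catalogue i) × ThreeDicritical (lookup catalogue i))
    × ((i j : Fin 8) → lookup catalogue i ≅ lookup catalogue j → i ≡ j)
    × ((D : Digraph) → SemiComplete D → ThreeDicritical D → ∃ λ i → D ≅ lookup catalogue i)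
theorem10 =
  (λ i → member-semi i , critical⇒dicritical (member i) (member-critical i) (member-noSink i)) ,
  (λ i j iso → member-distinct i j
    (≅⇒sameInvariants (member i) (member j) (member-semi i) (member-semi j) iso)) ,
  (λ D semi dicritical → Classify.classify D (dicritical⇒critical D semi dicritical))
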